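{- Fix $m\geq1$. Let $M$ and $N$ be loopless matroids such that their free $m$-cones $Q_m(M)$ and $Q_m(N)$ have the same configuration. Then $M$ and $N$ are isomorphic. (That is, the configuration of $Q_m(M)$ determines $M$ up to isomorphism.)
   Context: Cyclic set: $X$ with $M|X$ having no coloops; cyclic flat: a flat that is cyclic; $\mathcal{Z}(M)$: the lattice (under inclusion) of cyclic flats. The configuration of a matroid $M$ is the triple $(L,s,\rho)$ where $L$ is an abstract lattice with an isomorphism $\phi:L\to\mathcal{Z}(M)$, $s(x)=|\phi(x)|$ and $\rho(x)=r(\phi(x))$; two configurations are the same if there is a lattice isomorphism preserving $s$ and $\rho$. Free $m$-cone: let $M=(E,r)$ be loopless and $m\geq1$. For each $e\in E$ let $T_e$ be a set of $m$ new elements (pairwise disjoint, disjoint from $E$), $T=\bigcup_e T_e$, and $a$ a further new element (the tip); $E(Q)=E\cup T\cup\{a\}$. For $S\subseteq E$ let $q(S)=S\cup\{a\}\cup\bigcup_{e\in S}T_e$. The free $m$-cone $Q_m(M)$ is the unique matroid on $E(Q)$ whose cyclic flats are exactly the sets in $\mathcal{Z}(M)\cup\{q(F):F\text{ a nonempty flat of }M\}$, with rank $r(Z)$ on $Z\in\mathcal{Z}(M)$ and rank $r(F)+1$ on $q(F)$. -}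

module Defs where

open import Data.Nat using (ℕ; suc; _+_; _≤_; _<_)
open import Data.Bool using (Bool; true; false)
open import Data.Fin using (Fin)
open import Data.Fin.Subset using (Subset; _∈_; _∉_; _⊆_; _∪_; _∩_; _-_; ⁅_⁆; ∣_∣; Nonempty)
open import Data.Vec using (tabulate; lookup)
open import Data.Product using (Σ; ∃; _×_; _,_)
open import Data.Sum using (_⊎_)
open import Function.Bundles using (_↔_; Inverse; _⇔_)
open import Relation.Binary.PropositionalEquality using (_≡_)

record Matroid (n : ℕ) : Set where
  field
    r        : Subset n → ℕ
    r-bound  : ∀ X → r X ≤ ∣ X ∣
    r-mono   : ∀ X Y → X ⊆ Y → r X ≤ r Y
    r-submod : ∀ X Y → r (X ∪ Y) + r (X ∩ Y) ≤ r X + r Y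

open Matroid public

module _ {n : ℕ} (M : Matroid n) where

  Loopless : Set
  Loopless = ∀ e → r M ⁅ e ⁆ ≡ 1

  IsFlat : Subset n → Set
  IsFlat F = ∀ e → e ∉ F → r M F < r M (F ∪ ⁅ e ⁆)

  -- X is cyclic: M|X has no coloops, i.e. no e ∈ X with r(X - e) < r(X)
  IsCyclic : Subset n → Set
  IsCyclic X = ∀ e → e ∈ X → r M (X - e) ≡ r M X

  IsCyclicFlat : Subset n → Set
  IsCyclicFlat Z = IsCyclic Z × IsFlat Z

record SameConfiguration {k k' : ℕ} (M : Matroid k) (N : Matroid k') : Set where
  field
    to      : Subset k → Subset k'
    from    : Subset k' → Subset k
    to-cf   : ∀ Z → IsCyclicFlat M Z → IsCyclicFlat N (to Z)
    from-cf : ∀ W → IsCyclicFlat N W → IsCyclicFlat M (from W)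
    from-to : ∀ Z → IsCyclicFlat M Z → from (to Z) ≡ Z
    to-from : ∀ W → IsCyclicFlat N W → to (from W) ≡ W
    order   : ∀ Z Y → IsCyclicFlat M Z → IsCyclicFlat M Y → (Z ⊆ Y ⇔ to Z ⊆ to Y)
    size    : ∀ Z → IsCyclicFlat M Z → ∣ to Z ∣ ≡ ∣ Z ∣
    rank    : ∀ Z → IsCyclicFlat M Z → r N (to Z) ≡ r M Z

-- Matroid isomorphism: a bijection of ground sets preserving rank.
-- The image of X under σ is the preimage of X under σ⁻¹.
Isomorphic : {n n' : ℕ} → Matroid n → Matroid n' → Set
Isomorphic {n} {n'} M N =
  Σ (Fin n ↔ Fin n') λ σ →
    ∀ (X : Subset n) → r N (tabulate (λ y → lookup X (Inverse.from σ y))) ≡ r M X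

-- Abstract ground set of the free m-cone over a ground set Fin n:
-- the tip a, the original elements e, and the new elements T_e = {(e , j) : j < m}.
data ConeElt (n m : ℕ) : Set where
  tip  : ConeElt n m
  base : Fin n → ConeElt n m
  tail : Fin n → Fin m → ConeElt n m

module _ {n m : ℕ} where

  baseMem : Subset n → ConeElt n m → Bool
  baseMem S tip        = false
  baseMem S (base e)   = lookup S e
  baseMem S (tail e j) = false

  qMem : Subset n → ConeElt n m → Bool
  qMem S tip        = true
  qMem S (base e)   = lookup S e
  qMem S (tail e j) = lookup S e

record IsFreeCone {n k : ℕ} (m : ℕ) (M : Matroid n) (Q : Matroid k)
                  (lab : Fin k ↔ ConeElt n m) : Set where
  embE : Subset n → Subset k
  embE S = tabulate (λ x → baseMem S (Inverse.to lab x))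
  qSet : Subset n → Subset k
  qSet S = tabulate (λ x → qMem S (Inverse.to lab x))
  field
    cyclicFlats : ∀ (Z : Subset k) → IsCyclicFlat Q Z ⇔
      ((Σ (Subset n) λ Z' → IsCyclicFlat M Z' × Z ≡ embE Z')
       ⊎ (Σ (Subset n) λ F → IsFlat M F × Nonempty F × Z ≡ qSet F))
    rankZ : ∀ Z' → IsCyclicFlat M Z' → r Q (embE Z') ≡ r M Z'
    rankQ : ∀ F → IsFlat M F → Nonempty F → r Q (qSet F) ≡ suc (r M F)

{-# OPTIONS --safe #-}
module Submission where

-- Let E, E' be the ground sets of M, N.  By descending induction on flats, the configuration
-- isomorphism sends every cone q(F) to a cone or to E'.  The latter can happen, but then
-- some cone q(G) is the image of E, and matching F with G anyway still respects inclusion, size and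
-- rank.  So the nonempty flats of M and N correspond; matching the rank-1 flats element by element
-- gives a bijection E → E', which preserves rank because the rank of a set is that of the least
-- flat containing it.

open import Defs
open import Data.Nat using (ℕ; zero; suc; _+_; _*_; _≤_; _<_; _≥_; _≤?_; >-nonZero)
open import Data.Nat.Properties
open import Data.Nat.Tactic.RingSolver using (solve-∀)
open import Data.Bool using (true)
import Data.Bool.Properties as Bool
open import Data.Fin using (Fin; zero; suc; toℕ; cast; punchOut)
open import Data.Fin.Properties using (any?; all?; injective⇒≤; punchOut-injective; +↔⊎; *↔×; 1↔⊤)
import Data.Fin.Properties as Fin
open import Data.Fin.Permutation using (↔⇒≡)
open import Data.Fin.Subset using (Subset; inside; outside; _∈_; _∉_; _⊆_; _⊂_; _∪_; _∩_; ⁅_⁆; ∣_∣; Nonempty; ⊤; ⊥)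
open import Data.Fin.Subset.Properties
open import Data.Fin.Subset.Induction using (⊃-wellFounded; Acc; acc)
open import Data.Vec using (_∷_; []; here; there; tabulate; lookup)
open import Data.Vec.Properties using (≡-dec; []=⇒lookup; lookup⇒[]=; []=↔lookup; lookup∘tabulate)
open import Data.Vec.Properties.WithK using ([]=-irrelevant)
open import Data.Product using (Σ; ∃; _×_; _,_; proj₁; proj₂)
open import Data.Product.Function.Dependent.Propositional using (Σ-↔)
open import Data.Product.Function.NonDependent.Propositional using (_×-↔_)
open import Data.Sum using (_⊎_; inj₁; inj₂)
open import Data.Sum.Function.Propositional using (_⊎-↔_)
open import Data.Empty using (⊥-elim) renaming (⊥ to Absurd)
import Data.Unit as Unit
open import Function.Base using (_∘_)
open import Function.Bundles using (_↔_; _⇔_; Inverse; Equivalence; mk↔ₛ′; mk⇔)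
open import Function.Definitions using (Injective)
open import Function.Construct.Identity using (↔-id)
open import Function.Properties.Inverse using (↔-sym; ↔-trans)
open import Relation.Binary.PropositionalEquality using (_≡_; _≢_; refl; sym; trans; cong; subst; module ≡-Reasoning)
open import Relation.Nullary using (¬_; Dec; yes; no; ¬?; contradiction; _×-dec_; _→-dec_)

-- The obstacle is that a configuration forgets the tip: nothing in it marks which cyclic flats are
-- cones. Cones are worth recognising because |q(F)| = 1 + (m+1)|F| and r(q(F)) = r(F) + 1 give back
-- the size and rank of F, and cones are included in one another exactly as their flats are. The
-- induction descends because only the top is anchored: q(E) is the greatest cyclic flat, so its
-- image is q(E'). The exception E' cannot be excluded, but it is harmless. Lacking the tip, E'
-- contains no cone, and the only cone that contains it is q(E'). So if q(F) is sent to E', then F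
-- is minimal among the nonempty flats and has only E strictly above it: it is a point and a
-- hyperplane at once, and M has rank 2. In that position the inclusions of F with other flats carry
-- no information, which is why F can be matched with G.

private
  variable
    n n' m k k' : ℕ

-- Finite sets

_≟ₛ_ : (S T : Subset n) → Dec (S ≡ T)
_≟ₛ_ = ≡-dec Bool._≟_

full-or-missing : (S : Subset n) → S ≡ ⊤ ⊎ ∃ (_∉ S)
full-or-missing S with any? (λ e → ¬? (e ∈? S))
... | yes missing = inj₂ missing
... | no  full    = inj₁ (⊆-antisym ⊆⊤ λ {x} _ → in-S x)
  where
  in-S : ∀ x → x ∈ S
  in-S x with x ∈? S
  ... | yes x∈S = x∈S
  ... | no  x∉S = contradiction (x , x∉S) full

∪-lub : {S T U : Subset n} → S ⊆ U → T ⊆ U → S ∪ T ⊆ U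
∪-lub {S = S} {T} S⊆U T⊆U x∈ with x∈p∪q⁻ S T x∈
... | inj₁ x∈S = S⊆U x∈S
... | inj₂ x∈T = T⊆U x∈T

⁅⁆⊆ : {e : Fin n} {S : Subset n} → e ∈ S → ⁅ e ⁆ ⊆ S
⁅⁆⊆ {e = e} {S} e∈S x∈ = subst (_∈ S) (sym (x∈⁅y⁆⇒x≡y e x∈)) e∈S

e∈S∪⁅e⁆ : (S : Subset n) (e : Fin n) → e ∈ S ∪ ⁅ e ⁆
e∈S∪⁅e⁆ S e = q⊆p∪q S ⁅ e ⁆ (x∈⁅x⁆ e)

∣S∪T∣+∣S∩T∣≡∣S∣+∣T∣ : (S T : Subset n) → ∣ S ∪ T ∣ + ∣ S ∩ T ∣ ≡ ∣ S ∣ + ∣ T ∣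
∣S∪T∣+∣S∩T∣≡∣S∣+∣T∣ []            []            = refl
∣S∪T∣+∣S∩T∣≡∣S∣+∣T∣ (outside ∷ S) (outside ∷ T) = ∣S∪T∣+∣S∩T∣≡∣S∣+∣T∣ S T
∣S∪T∣+∣S∩T∣≡∣S∣+∣T∣ (inside  ∷ S) (outside ∷ T) = cong suc (∣S∪T∣+∣S∩T∣≡∣S∣+∣T∣ S T)
∣S∪T∣+∣S∩T∣≡∣S∣+∣T∣ (outside ∷ S) (inside  ∷ T) =
  trans (cong suc (∣S∪T∣+∣S∩T∣≡∣S∣+∣T∣ S T)) (sym (+-suc ∣ S ∣ ∣ T ∣))
∣S∪T∣+∣S∩T∣≡∣S∣+∣T∣ (inside  ∷ S) (inside  ∷ T) = cong suc (begin
  ∣ S ∪ T ∣ + suc ∣ S ∩ T ∣   ≡⟨ +-suc ∣ S ∪ T ∣ ∣ S ∩ T ∣ ⟩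
  suc (∣ S ∪ T ∣ + ∣ S ∩ T ∣) ≡⟨ cong suc (∣S∪T∣+∣S∩T∣≡∣S∣+∣T∣ S T) ⟩
  suc (∣ S ∣ + ∣ T ∣)         ≡⟨ +-suc ∣ S ∣ ∣ T ∣ ⟨
  ∣ S ∣ + suc ∣ T ∣           ∎)
  where open ≡-Reasoning

nth : (S : Subset n) → Fin ∣ S ∣ → ∃ (_∈ S)
nth (inside  ∷ S) zero    = zero , here
nth (inside  ∷ S) (suc i) = let x , x∈S = nth S i in suc x , there x∈S
nth (outside ∷ S) i       = let x , x∈S = nth S i in suc x , there x∈S

position : (S : Subset n) → ∃ (_∈ S) → Fin ∣ S ∣
position (inside  ∷ S) (zero  , _)         = zero
position (inside  ∷ S) (suc x , there x∈S) = suc (position S (x , x∈S))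
position (outside ∷ S) (suc x , there x∈S) = position S (x , x∈S)

nth-position : (S : Subset n) (x : ∃ (_∈ S)) → nth S (position S x) ≡ x
nth-position (inside  ∷ S) (zero  , here)      = refl
nth-position (inside  ∷ S) (suc x , there x∈S) =
  cong (λ (y , y∈S) → suc y , there y∈S) (nth-position S (x , x∈S))
nth-position (outside ∷ S) (suc x , there x∈S) =
  cong (λ (y , y∈S) → suc y , there y∈S) (nth-position S (x , x∈S))

position-nth : (S : Subset n) (i : Fin ∣ S ∣) → position S (nth S i) ≡ i
position-nth (inside  ∷ S) zero    = refl
position-nth (inside  ∷ S) (suc i) = cong suc (position-nth S i)
position-nth (outside ∷ S) i       = position-nth S i

Fin∣S∣↔S : (S : Subset n) → Fin ∣ S ∣ ↔ ∃ (_∈ S)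
Fin∣S∣↔S S = mk↔ₛ′ (nth S) (position S) (nth-position S) (position-nth S)

abstract
  transfer : (S : Subset n) (T : Subset n') → ∣ S ∣ ≡ ∣ T ∣ → ∃ (_∈ S) → ∃ (_∈ T)
  transfer S T eq x = nth T (cast eq (position S x))

  -- `transfer` depends only on the two sets and on the position of the member, so all members of
  -- one point are moved by one bijection. The equations between sets are arguments because closures
  -- of different elements of a point agree only propositionally.
  transfer-injective : {S S₁ : Subset n} {T T₁ : Subset n'} {eq : ∣ S ∣ ≡ ∣ T ∣} {eq₁ : ∣ S₁ ∣ ≡ ∣ T₁ ∣} →
    S ≡ S₁ → T ≡ T₁ → (x : ∃ (_∈ S)) (y : ∃ (_∈ S₁)) →
    proj₁ (transfer S T eq x) ≡ proj₁ (transfer S₁ T₁ eq₁ y) → proj₁ x ≡ proj₁ y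
  transfer-injective {S = S} {T = T} {eq = eq} {eq₁} refl refl x y tx≡ty = cong proj₁ x≡y
    where
    same : ∀ {u v : ∃ (_∈ T)} → proj₁ u ≡ proj₁ v → u ≡ v
    same {z , p} {.z , q} refl = cong (z ,_) ([]=-irrelevant p q)

    cast≡ : cast eq (position S x) ≡ cast eq₁ (position S y)
    cast≡ = trans (sym (position-nth T _)) (trans (cong (position T) (same tx≡ty)) (position-nth T _))

    position≡ : position S x ≡ position S y
    position≡ = Fin.toℕ-injective (trans (sym (Fin.toℕ-cast eq _))
      (trans (cong toℕ cast≡) (Fin.toℕ-cast eq₁ _)))

    x≡y : x ≡ y
    x≡y = trans (sym (nth-position S x)) (trans (cong (nth S) position≡) (nth-position S y))

abstract
  -- Pigeonhole: a missed value could be punched out, leaving an injection into a smaller `Fin`.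
  injective⇒surjective : n ≡ n' → {f : Fin n → Fin n'} → Injective _≡_ _≡_ f → ∀ y → ∃ λ x → f x ≡ y
  injective⇒surjective {suc n} refl {f} f-inj y with any? (λ x → f x Fin.≟ y)
  ... | yes hit = hit
  ... | no ¬hit = contradiction (injective⇒≤ avoid-injective) 1+n≰n
    where
    y≢f : ∀ x → y ≢ f x
    y≢f x y≡fx = ¬hit (x , sym y≡fx)

    avoid-injective : Injective _≡_ _≡_ (λ x → punchOut (y≢f x))
    avoid-injective {x} {z} = f-inj ∘ punchOut-injective (y≢f x) (y≢f z)

-- Matroids

module _ (M : Matroid n) where

  r-⊥ : r M ⊥ ≡ 0
  r-⊥ = n≤0⇒n≡0 (subst (r M ⊥ ≤_) (∣⊥∣≡0 n) (r-bound M ⊥))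

  -- Submodularity for X ∪ {e} and Y: their union contains Y ∪ {e} and their intersection contains
  -- X.
  r-absorb : ∀ {X Y} e → X ⊆ Y → r M (X ∪ ⁅ e ⁆) ≤ r M X → r M (Y ∪ ⁅ e ⁆) ≤ r M Y
  r-absorb {X} {Y} e X⊆Y absorbed = +-cancelʳ-≤ (r M X) (r M (Y ∪ ⁅ e ⁆)) (r M Y) (begin
    r M (Y ∪ ⁅ e ⁆) + r M X
      ≤⟨ +-mono-≤
           (r-mono M _ _ (∪-lub (q⊆p∪q (X ∪ ⁅ e ⁆) Y) (p⊆p∪q Y ∘ q⊆p∪q X ⁅ e ⁆)))
           (r-mono M _ _ (λ x∈X → x∈p∩q⁺ (p⊆p∪q ⁅ e ⁆ x∈X , X⊆Y x∈X))) ⟩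
    r M ((X ∪ ⁅ e ⁆) ∪ Y) + r M ((X ∪ ⁅ e ⁆) ∩ Y) ≤⟨ r-submod M _ _ ⟩
    r M (X ∪ ⁅ e ⁆) + r M Y                       ≤⟨ +-monoˡ-≤ (r M Y) absorbed ⟩
    r M X + r M Y                                 ≡⟨ +-comm (r M X) (r M Y) ⟩
    r M Y + r M X                                 ∎)
    where open ≤-Reasoning

  r-∪⁅⁆ : ∀ X e → r M (X ∪ ⁅ e ⁆) ≤ suc (r M X)
  r-∪⁅⁆ X e = begin
    r M (X ∪ ⁅ e ⁆)                     ≤⟨ m≤m+n _ _ ⟩
    r M (X ∪ ⁅ e ⁆) + r M (X ∩ ⁅ e ⁆)   ≤⟨ r-submod M X ⁅ e ⁆ ⟩
    r M X + r M ⁅ e ⁆                   ≤⟨ +-monoʳ-≤ (r M X) (r-bound M ⁅ e ⁆) ⟩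
    r M X + ∣ ⁅ e ⁆ ∣                   ≡⟨ cong (r M X +_) (∣⁅x⁆∣≡1 e) ⟩
    r M X + 1                           ≡⟨ +-comm (r M X) 1 ⟩
    suc (r M X)                         ∎
    where open ≤-Reasoning

  isFlat? : ∀ F → Dec (IsFlat M F)
  isFlat? F = all? λ e → ¬? (e ∈? F) →-dec (suc (r M F) ≤? r M (F ∪ ⁅ e ⁆))

  ⊤-flat : IsFlat M ⊤
  ⊤-flat e e∉⊤ = contradiction ∈⊤ e∉⊤

  flat-⊆-rank : ∀ {F G} → IsFlat M F → F ⊆ G → r M G ≤ r M F → G ≡ F
  flat-⊆-rank {F} {G} F-flat F⊆G rG≤rF = ⊆-antisym G⊆F F⊆G
    where
    G⊆F : G ⊆ F
    G⊆F {x} x∈G with x ∈? F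
    ... | yes x∈F = x∈F
    ... | no  x∉F = contradiction
      (<-≤-trans (F-flat x x∉F) (≤-trans (r-mono M _ _ (∪-lub F⊆G (⁅⁆⊆ x∈G))) rG≤rF)) (<-irrefl refl)

  record Closure (X : Subset n) : Set where
    field
      cl      : Subset n
      X⊆cl    : X ⊆ cl
      cl-flat : IsFlat M cl
      r-cl    : r M cl ≡ r M X
      least   : ∀ {G} → IsFlat M G → X ⊆ G → cl ⊆ G

  abstract
    -- Elements that do not raise the rank are added one at a time, so the set grows strictly and
    -- the recursion ends. Leastness survives each step: by `r-absorb`, a flat above X already
    -- contains the added element.
    closure-acc : ∀ X → Acc (λ S T → T ⊂ S) X → Closure X
    closure-acc X (acc rec) with any? (λ e → ¬? (e ∈? X) ×-dec (r M (X ∪ ⁅ e ⁆) ≤? r M X))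
    ... | no none = record
      { cl      = X
      ; X⊆cl    = λ x∈X → x∈X
      ; cl-flat = λ e e∉X → ≰⇒> λ absorbed → none (e , e∉X , absorbed)
      ; r-cl    = refl
      ; least   = λ _ X⊆G → X⊆G
      }
    ... | yes (e , e∉X , absorbed) = record
      { cl      = cl
      ; X⊆cl    = X⊆cl ∘ p⊆p∪q ⁅ e ⁆
      ; cl-flat = cl-flat
      ; r-cl    = trans r-cl (≤-antisym absorbed (r-mono M _ _ (p⊆p∪q ⁅ e ⁆)))
      ; least   = λ {G} G-flat X⊆G → least G-flat (∪-lub X⊆G (⁅⁆⊆ (e∈G G-flat X⊆G)))
      }
      where
      open Closure (closure-acc (X ∪ ⁅ e ⁆) (rec (p⊆p∪q ⁅ e ⁆ , e , e∈S∪⁅e⁆ X e , e∉X)))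

      e∈G : ∀ {G} → IsFlat M G → X ⊆ G → e ∈ G
      e∈G {G} G-flat X⊆G with e ∈? G
      ... | yes e∈ = e∈
      ... | no  e∉ = contradiction (<-≤-trans (G-flat e e∉) (r-absorb e X⊆G absorbed)) (<-irrefl refl)

    closure : ∀ X → Closure X
    closure X = closure-acc X (⊃-wellFounded X)

  module _ (X : Subset n) where
    open Closure (closure X) public

  module Cover {F : Subset n} (F-flat : IsFlat M F) {e : Fin n} (e∉F : e ∉ F) where

    cover : Subset n
    cover = cl (F ∪ ⁅ e ⁆)

    ∈-cover : e ∈ cover
    ∈-cover = X⊆cl _ (e∈S∪⁅e⁆ F e)

    ⊆-cover : F ⊆ cover
    ⊆-cover = X⊆cl _ ∘ p⊆p∪q ⁅ e ⁆

    r-cover : r M cover ≡ suc (r M F)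
    r-cover = trans (r-cl _) (≤-antisym (r-∪⁅⁆ F e) (F-flat e e∉F))

  -- In a loopless matroid this is the parallel class of `e`, the only rank-1 flat through it.
  point : Fin n → Subset n
  point e = cl ⁅ e ⁆

  e∈point : ∀ e → e ∈ point e
  e∈point e = X⊆cl ⁅ e ⁆ (x∈⁅x⁆ e)

  point-flat : ∀ e → IsFlat M (point e)
  point-flat e = cl-flat ⁅ e ⁆

  point⊆ : ∀ {e F} → IsFlat M F → e ∈ F → point e ⊆ F
  point⊆ {e} F-flat e∈F = least ⁅ e ⁆ F-flat (⁅⁆⊆ e∈F)

  module _ (loopless : Loopless M) where

    r-point : ∀ e → r M (point e) ≡ 1
    r-point e = trans (r-cl ⁅ e ⁆) (loopless e)

    rank-1-flat : ∀ {e F} → IsFlat M F → r M F ≡ 1 → e ∈ F → F ≡ point e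
    rank-1-flat {e} F-flat rF≡1 e∈F =
      flat-⊆-rank (point-flat e) (point⊆ F-flat e∈F) (≤-reflexive (trans rF≡1 (sym (r-point e))))

-- From matched points to matched elements

record PointMap (N : Matroid n') (φ : Fin n → Subset n') : Set where
  field
    f           : Fin n → Fin n'
    f∈φ         : ∀ e → f e ∈ φ e
    φ≡point     : ∀ e → φ e ≡ point N (f e)
    f-injective : Injective _≡_ _≡_ f

-- Points are pairwise disjoint, so a matching of equicardinal points lifts to a matching of elements.
pointMap : (M : Matroid n) (N : Matroid n') → Loopless N → (φ : Fin n → Subset n') →
  (∀ e → IsFlat N (φ e)) → (∀ e → r N (φ e) ≡ 1) → (∀ e → ∣ point M e ∣ ≡ ∣ φ e ∣) →
  (∀ {d e} → φ d ≡ φ e → point M d ≡ point M e) → PointMap N φ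
pointMap {n} {n'} M N looplessN φ φ-flat r-φ ∣φ∣ φ-injective = record
  { f           = f
  ; f∈φ         = f∈φ
  ; φ≡point     = φ≡point
  -- A common value lies in both φ d and φ e, so both are its point; then d and e share a point,
  -- within which `transfer` is injective.
  ; f-injective = λ {d} {e} fd≡fe →
      let φd≡φe = trans (φ≡point d) (trans (cong (point N) fd≡fe) (sym (φ≡point e)))
      in transfer-injective {eq = ∣φ∣ d} {∣φ∣ e} (φ-injective φd≡φe) φd≡φe (d , e∈point M d) (e , e∈point M e) fd≡fe
  }
  where
  f : Fin n → Fin n'
  f e = proj₁ (transfer (point M e) (φ e) (∣φ∣ e) (e , e∈point M e))

  f∈φ : ∀ e → f e ∈ φ e
  f∈φ e = proj₂ (transfer (point M e) (φ e) (∣φ∣ e) (e , e∈point M e))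

  φ≡point : ∀ e → φ e ≡ point N (f e)
  φ≡point e = rank-1-flat N looplessN (φ-flat e) (r-φ e) (f∈φ e)

-- A loopless matroid is determined by the ranks, sizes and inclusions of its nonempty flats.
module FlatCorrespondence (M : Matroid n) (N : Matroid n')
  (looplessM : Loopless M) (looplessN : Loopless N) (equicardinal : n ≡ n')
  (_~_ : Subset n → Subset n' → Set)
  (~-mono : ∀ {F₁ F₂ G₁ G₂} → IsFlat M F₁ → Nonempty F₁ → IsFlat M F₂ → Nonempty F₂ →
    F₁ ~ G₁ → F₂ ~ G₂ → F₁ ⊆ F₂ → G₁ ⊆ G₂)
  (~-cancel : ∀ {F₁ F₂ G₁ G₂} → IsFlat M F₁ → Nonempty F₁ → IsFlat M F₂ → Nonempty F₂ →
    F₁ ~ G₁ → F₂ ~ G₂ → G₁ ⊆ G₂ → F₁ ⊆ F₂)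
  (~-size : ∀ {F G} → IsFlat M F → Nonempty F → F ~ G → ∣ F ∣ ≡ ∣ G ∣)
  (~-rank : ∀ {F G} → IsFlat M F → Nonempty F → IsFlat N G → Nonempty G → F ~ G → r M F ≡ r N G)
  (~-total : ∀ {F} → IsFlat M F → Nonempty F → ∃ λ G → IsFlat N G × Nonempty G × F ~ G)
  (~-onto : ∀ {G} → IsFlat N G → Nonempty G → ∃ λ F → IsFlat M F × Nonempty F × F ~ G)
  where

  point≢∅ : ∀ e → Nonempty (point M e)
  point≢∅ e = e , e∈point M e

  partner : ∀ e → ∃ λ G → IsFlat N G × Nonempty G × point M e ~ G
  partner e = ~-total (point-flat M e) (point≢∅ e)

  φ : Fin n → Subset n'
  φ e = proj₁ (partner e)

  φ-flat : ∀ e → IsFlat N (φ e)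
  φ-flat e = proj₁ (proj₂ (partner e))

  φ≢∅ : ∀ e → Nonempty (φ e)
  φ≢∅ e = proj₁ (proj₂ (proj₂ (partner e)))

  point~φ : ∀ e → point M e ~ φ e
  point~φ e = proj₂ (proj₂ (proj₂ (partner e)))

  φ-cancel : ∀ {d e} → φ d ⊆ φ e → point M d ⊆ point M e
  φ-cancel {d} {e} = ~-cancel (point-flat M d) (point≢∅ d) (point-flat M e) (point≢∅ e) (point~φ d) (point~φ e)

  abstract
    elementMap : PointMap N φ
    elementMap = pointMap M N looplessN φ φ-flat
      (λ e → trans (sym (~-rank (point-flat M e) (point≢∅ e) (φ-flat e) (φ≢∅ e) (point~φ e))) (r-point M looplessM e))
      (λ e → ~-size (point-flat M e) (point≢∅ e) (point~φ e))
      (λ φd≡φe → ⊆-antisym (φ-cancel (⊆-reflexive φd≡φe)) (φ-cancel (⊆-reflexive (sym φd≡φe))))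

  open PointMap elementMap

  g : Fin n' → Fin n
  g y = proj₁ (injective⇒surjective equicardinal f-injective y)

  f∘g : ∀ y → f (g y) ≡ y
  f∘g y = proj₂ (injective⇒surjective equicardinal f-injective y)

  g∘f : ∀ x → g (f x) ≡ x
  g∘f x = f-injective (f∘g (f x))

  image : Subset n → Subset n'
  image X = tabulate (λ y → lookup X (g y))

  ∈-image⁻ : ∀ {X y} → y ∈ image X → g y ∈ X
  ∈-image⁻ {X} {y} y∈ = lookup⇒[]= (g y) X (trans (sym (lookup∘tabulate _ y)) ([]=⇒lookup y∈))

  ∈-image⁺ : ∀ {X e} → e ∈ X → f e ∈ image X
  ∈-image⁺ {X} {e} e∈X = lookup⇒[]= (f e) _
    (trans (lookup∘tabulate _ (f e)) (trans (cong (lookup X) (g∘f e)) ([]=⇒lookup e∈X)))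

  -- The partner G of the closure of X has the rank of X. It contains the image, since the point of
  -- each e in X lies in that closure and monotonicity puts φ e, hence f e, inside G.
  r-image-≤ : ∀ {X} → Nonempty X → r N (image X) ≤ r M X
  r-image-≤ {X} (d , d∈X) with ~-total (cl-flat M X) (d , X⊆cl M X d∈X)
  ... | G , G-flat , G≢∅ , cl~G = begin
    r N (image X)  ≤⟨ r-mono N _ _ image⊆G ⟩
    r N G          ≡⟨ ~-rank (cl-flat M X) (d , X⊆cl M X d∈X) G-flat G≢∅ cl~G ⟨
    r M (cl M X)   ≡⟨ r-cl M X ⟩
    r M X          ∎
    where
    open ≤-Reasoning
    image⊆G : image X ⊆ G
    image⊆G {y} y∈ = subst (_∈ G) (f∘g y)
      (~-mono (point-flat M (g y)) (point≢∅ (g y)) (cl-flat M X) (d , X⊆cl M X d∈X) (point~φ (g y)) cl~G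
        (point⊆ M (cl-flat M X) (X⊆cl M X (∈-image⁻ y∈))) (f∈φ (g y)))

  -- The mirror argument: the partner F of the closure of the image contains X, by cancelling the
  -- inclusion of each φ e in that closure.
  r-image-≥ : ∀ {X} → Nonempty X → r M X ≤ r N (image X)
  r-image-≥ {X} (d , d∈X) with ~-onto (cl-flat N (image X)) (f d , X⊆cl N (image X) (∈-image⁺ d∈X))
  ... | F , F-flat , F≢∅ , F~cl = begin
    r M X                 ≤⟨ r-mono M _ _ X⊆F ⟩
    r M F                 ≡⟨ ~-rank F-flat F≢∅ (cl-flat N (image X)) cl≢∅ F~cl ⟩
    r N (cl N (image X))  ≡⟨ r-cl N (image X) ⟩
    r N (image X)         ∎
    where
    open ≤-Reasoning
    cl≢∅ : Nonempty (cl N (image X))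
    cl≢∅ = f d , X⊆cl N (image X) (∈-image⁺ d∈X)

    φ⊆cl : ∀ {e} → e ∈ X → φ e ⊆ cl N (image X)
    φ⊆cl {e} e∈X = subst (_⊆ cl N (image X)) (sym (φ≡point e))
      (point⊆ N (cl-flat N (image X)) (X⊆cl N (image X) (∈-image⁺ e∈X)))

    X⊆F : X ⊆ F
    X⊆F {e} e∈X = ~-cancel (point-flat M e) (point≢∅ e) F-flat F≢∅ (point~φ e) F~cl
      (φ⊆cl e∈X) (e∈point M e)

  r-image : ∀ X → r N (image X) ≡ r M X
  r-image X with nonempty? X
  ... | yes X≢∅ = ≤-antisym (r-image-≤ X≢∅) (r-image-≥ X≢∅)
  -- Only nonempty flats have partners, so the empty set is handled by its rank 0.
  ... | no X≡∅ = begin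
    r N (image X) ≡⟨ cong (r N) (Empty-unique λ (y , y∈) → X≡∅ (g y , ∈-image⁻ y∈)) ⟩
    r N ⊥         ≡⟨ r-⊥ N ⟩
    0             ≡⟨ r-⊥ M ⟨
    r M ⊥         ≡⟨ cong (r M) (Empty-unique X≡∅) ⟨
    r M X         ∎
    where open ≡-Reasoning

  isomorphic : Isomorphic M N
  isomorphic = mk↔ₛ′ f g f∘g g∘f , r-image

-- Free cones

-- The size of q(S) for |S| = s: the tip, the s base elements, and m new elements for each of them.
coneSize : ℕ → ℕ → ℕ
coneSize m s = suc (s + s * m)

coneSize-injective : ∀ m {s t} → coneSize m s ≡ coneSize m t → s ≡ t
coneSize-injective m {s} {t} eq = *-cancelʳ-≡ s t (suc m)
  (trans (*-suc s m) (trans (suc-injective eq) (sym (*-suc t m))))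

module FreeCone {M : Matroid n} {Q : Matroid k} {lab : Fin k ↔ ConeElt n m} (C : IsFreeCone m M Q lab) where
  open IsFreeCone C public

  label : Fin k → ConeElt n m
  label = Inverse.to lab

  unlabel : ConeElt n m → Fin k
  unlabel = Inverse.from lab

  ∈-tabulate : ∀ f {x} → x ∈ tabulate (f ∘ label) → f (label x) ≡ true
  ∈-tabulate f {x} x∈ = trans (sym (lookup∘tabulate _ x)) ([]=⇒lookup x∈)

  tabulate-∈ : ∀ f {x} → f (label x) ≡ true → x ∈ tabulate (f ∘ label)
  tabulate-∈ f {x} fx = lookup⇒[]= x _ (trans (lookup∘tabulate _ x) fx)

  ∈-tabulate-unlabel : ∀ f {c} → unlabel c ∈ tabulate (f ∘ label) → f c ≡ true
  ∈-tabulate-unlabel f {c} c∈ = subst (λ d → f d ≡ true) (Inverse.strictlyInverseˡ lab c) (∈-tabulate f c∈)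

  tabulate-unlabel-∈ : ∀ f {c} → f c ≡ true → unlabel c ∈ tabulate (f ∘ label)
  tabulate-unlabel-∈ f {c} fc = tabulate-∈ f (subst (λ d → f d ≡ true) (sym (Inverse.strictlyInverseˡ lab c)) fc)

  tabulate-mono : ∀ f g → (∀ c → f c ≡ true → g c ≡ true) → tabulate (f ∘ label) ⊆ tabulate (g ∘ label)
  tabulate-mono f g f⇒g = tabulate-∈ g ∘ f⇒g _ ∘ ∈-tabulate f

  lookup-mono : ∀ {S T : Subset n} {e} → S ⊆ T → lookup S e ≡ true → lookup T e ≡ true
  lookup-mono {S} {e = e} S⊆T Se = []=⇒lookup (S⊆T (lookup⇒[]= e S Se))

  q-mono : ∀ {S T} → S ⊆ T → qSet S ⊆ qSet T
  q-mono {S} {T} S⊆T = tabulate-mono (qMem S) (qMem T) λ where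
    tip        _  → refl
    (base e)   Se → lookup-mono {S} {T} S⊆T Se
    (tail e j) Se → lookup-mono {S} {T} S⊆T Se

  emb⊆q : ∀ {S T} → S ⊆ T → embE S ⊆ qSet T
  emb⊆q {S} {T} S⊆T = tabulate-mono (baseMem S) (qMem T) λ where
    (base e) Se → lookup-mono {S} {T} S⊆T Se

  q-cancel : ∀ {S T} → qSet S ⊆ qSet T → S ⊆ T
  q-cancel {S} {T} qS⊆qT {e} e∈S = lookup⇒[]= e T
    (∈-tabulate-unlabel (qMem T) {base e} (qS⊆qT (tabulate-unlabel-∈ (qMem S) {base e} ([]=⇒lookup e∈S))))

  emb-q-cancel : ∀ {S T} → embE S ⊆ qSet T → S ⊆ T
  emb-q-cancel {S} {T} eS⊆qT {e} e∈S = lookup⇒[]= e T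
    (∈-tabulate-unlabel (qMem T) {base e} (eS⊆qT (tabulate-unlabel-∈ (baseMem S) {base e} ([]=⇒lookup e∈S))))

  -- The tip lies in every cone and in no subset of the base.
  q⊈emb : ∀ {S T} → ¬ (qSet S ⊆ embE T)
  q⊈emb {S} {T} qS⊆eT
    with () ← ∈-tabulate-unlabel (baseMem T) {tip} (qS⊆eT (tabulate-unlabel-∈ (qMem S) {tip} refl))

  q≢emb : ∀ {S T} → qSet S ≢ embE T
  q≢emb qS≡eT = q⊈emb (⊆-reflexive qS≡eT)

  q-injective : ∀ {S T} → qSet S ≡ qSet T → S ≡ T
  q-injective qS≡qT = ⊆-antisym (q-cancel (⊆-reflexive qS≡qT)) (q-cancel (⊆-reflexive (sym qS≡qT)))

  tabulate↔ : ∀ f → ∃ (_∈ tabulate (f ∘ label)) ↔ ∃ λ c → f c ≡ true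
  tabulate↔ f = Σ-↔ lab λ {x} → ↔-trans []=↔lookup (≡-trans↔ (lookup∘tabulate (f ∘ label) x))
    where
    ≡-trans↔ : ∀ {a b c} → a ≡ b → (a ≡ c) ↔ (b ≡ c)
    ≡-trans↔ refl = ↔-id _

  members↔ : (S : Subset n) → Fin ∣ S ∣ ↔ ∃ λ e → lookup S e ≡ true
  members↔ S = ↔-trans (Fin∣S∣↔S S) (Σ-↔ (↔-id _) []=↔lookup)

  ∣emb∣ : ∀ S → ∣ embE S ∣ ≡ ∣ S ∣
  ∣emb∣ S = ↔⇒≡ (↔-trans (Fin∣S∣↔S (embE S)) (↔-trans (tabulate↔ (baseMem S)) (↔-trans strip (↔-sym (members↔ S)))))
    where
    strip : (∃ λ c → baseMem S c ≡ true) ↔ ∃ λ e → lookup S e ≡ true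
    strip = mk↔ₛ′ (λ { (base e , Se) → e , Se }) (λ (e , Se) → base e , Se)
      (λ _ → refl) (λ { (base e , Se) → refl })

  ∣q∣ : ∀ S → ∣ qSet S ∣ ≡ coneSize m ∣ S ∣
  ∣q∣ S = ↔⇒≡ (↔-trans (Fin∣S∣↔S (qSet S)) (↔-trans (tabulate↔ (qMem S)) (↔-trans split (↔-sym count))))
    where
    Members : Set
    Members = ∃ λ e → lookup S e ≡ true

    split : (∃ λ c → qMem S c ≡ true) ↔ (Unit.⊤ ⊎ (Members ⊎ (Members × Fin m)))
    split = mk↔ₛ′
      (λ { (tip , refl) → inj₁ Unit.tt ; (base e , Se) → inj₂ (inj₁ (e , Se)) ; (tail e j , Se) → inj₂ (inj₂ ((e , Se) , j)) })
      (λ { (inj₁ _) → tip , refl ; (inj₂ (inj₁ (e , Se))) → base e , Se ; (inj₂ (inj₂ ((e , Se) , j))) → tail e j , Se })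
      (λ { (inj₁ _) → refl ; (inj₂ (inj₁ _)) → refl ; (inj₂ (inj₂ _)) → refl })
      (λ { (tip , refl) → refl ; (base _ , _) → refl ; (tail _ _ , _) → refl })

    count : Fin (coneSize m ∣ S ∣) ↔ (Unit.⊤ ⊎ (Members ⊎ (Members × Fin m)))
    count = ↔-trans (+↔⊎ {1}) (1↔⊤ ⊎-↔ ↔-trans +↔⊎ (members↔ S ⊎-↔ ↔-trans *↔× (members↔ S ×-↔ ↔-id _)))

  classify : ∀ {Z} → IsCyclicFlat Q Z →
    (Σ (Subset n) λ Z' → IsCyclicFlat M Z' × Z ≡ embE Z') ⊎
    (Σ (Subset n) λ F → IsFlat M F × Nonempty F × Z ≡ qSet F)
  classify {Z} = Equivalence.to (cyclicFlats Z)

  q-cf : ∀ {F} → IsFlat M F → Nonempty F → IsCyclicFlat Q (qSet F)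
  q-cf {F} F-flat F≢∅ = Equivalence.from (cyclicFlats (qSet F)) (inj₂ (F , F-flat , F≢∅ , refl))

  -- Needed because `rankZ` speaks only of cyclic flats of M. The classification yields some Z with
  -- the same embedding as E, and its size forces Z = E.
  emb⊤-cf⁻¹ : IsCyclicFlat Q (embE ⊤) → IsCyclicFlat M ⊤
  emb⊤-cf⁻¹ ⊤-cf with classify ⊤-cf
  ... | inj₂ (_ , _ , _ , emb≡q)  = ⊥-elim (q≢emb (sym emb≡q))
  ... | inj₁ (Z , Z-cf , emb≡emb) = subst (IsCyclicFlat M) (∣p∣≡n⇒p≡⊤ ∣Z∣≡n) Z-cf
    where
    ∣Z∣≡n : ∣ Z ∣ ≡ n
    ∣Z∣≡n = trans (sym (∣emb∣ Z)) (trans (cong ∣_∣ (sym emb≡emb)) (trans (∣emb∣ ⊤) (∣⊤∣≡n n)))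

  r-emb⊤ : IsCyclicFlat Q (embE ⊤) → r Q (embE ⊤) ≡ r M ⊤
  r-emb⊤ ⊤-cf = rankZ ⊤ (emb⊤-cf⁻¹ ⊤-cf)

  ⊆q⊤ : ∀ {Z} → IsCyclicFlat Q Z → Z ⊆ qSet ⊤
  ⊆q⊤ Z-cf with classify Z-cf
  ... | inj₁ (_ , _ , refl)     = emb⊆q ⊆⊤
  ... | inj₂ (_ , _ , _ , refl) = q-mono ⊆⊤

-- Configurations

SameConfiguration-sym : {M : Matroid k} {N : Matroid k'} → SameConfiguration M N → SameConfiguration N M
SameConfiguration-sym {M = M} {N} conf = record
  { to      = from
  ; from    = to
  ; to-cf   = from-cf
  ; from-cf = to-cf
  ; from-to = to-from
  ; to-from = from-to
  ; order   = from-order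
  ; size    = λ W W-cf → trans (sym (size (from W) (from-cf W W-cf))) (cong ∣_∣ (to-from W W-cf))
  ; rank    = λ W W-cf → trans (sym (rank (from W) (from-cf W W-cf))) (cong (r N) (to-from W W-cf))
  }
  where
  open SameConfiguration conf

  from-order : ∀ W V → IsCyclicFlat N W → IsCyclicFlat N V → (W ⊆ V ⇔ from W ⊆ from V)
  from-order W V W-cf V-cf = mk⇔ {A = W ⊆ V} {B = from W ⊆ from V}
    (λ W⊆V → Equivalence.from ordered λ {x} → forth W⊆V {x}) (λ fW⊆fV → back (Equivalence.to ordered fW⊆fV))
    where
    ordered : from W ⊆ from V ⇔ to (from W) ⊆ to (from V)
    ordered = order (from W) (from V) (from-cf W W-cf) (from-cf V V-cf)

    forth : W ⊆ V → to (from W) ⊆ to (from V)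
    forth W⊆V {x} x∈ = subst (x ∈_) (sym (to-from V V-cf)) (W⊆V (subst (x ∈_) (to-from W W-cf) x∈))

    back : to (from W) ⊆ to (from V) → W ⊆ V
    back sub {x} x∈W = subst (x ∈_) (to-from V V-cf) (sub (subst (x ∈_) (sym (to-from W W-cf)) x∈W))

-- Images of cones under a configuration isomorphism

module ConeConfiguration (m≥1 : m ≥ 1) {M : Matroid n} {N : Matroid n'}
  {QM : Matroid k} {labM : Fin k ↔ ConeElt n m} (C : IsFreeCone m M QM labM)
  {QN : Matroid k'} {labN : Fin k' ↔ ConeElt n' m} (C' : IsFreeCone m N QN labN)
  (conf : SameConfiguration QM QN) where

  open SameConfiguration conf
  private
    module A = FreeCone C
    module B = FreeCone C'

  to-injective : ∀ {Z Y} → IsCyclicFlat QM Z → IsCyclicFlat QM Y → to Z ≡ to Y → Z ≡ Y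
  to-injective {Z} {Y} Z-cf Y-cf toZ≡toY =
    trans (sym (from-to Z Z-cf)) (trans (cong from toZ≡toY) (from-to Y Y-cf))

  to-mono : ∀ {Z Y} → IsCyclicFlat QM Z → IsCyclicFlat QM Y → Z ⊆ Y → to Z ⊆ to Y
  to-mono {Z} {Y} Z-cf Y-cf = Equivalence.to (order Z Y Z-cf Y-cf)

  to-cancel : ∀ {Z Y} → IsCyclicFlat QM Z → IsCyclicFlat QM Y → to Z ⊆ to Y → Z ⊆ Y
  to-cancel {Z} {Y} Z-cf Y-cf = Equivalence.from (order Z Y Z-cf Y-cf)

  r-to-q : ∀ {F} → IsFlat M F → Nonempty F → r QN (to (A.qSet F)) ≡ suc (r M F)
  r-to-q {F} F-flat F≢∅ = trans (rank _ (A.q-cf F-flat F≢∅)) (A.rankQ F F-flat F≢∅)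

  ∣to-q∣ : ∀ {F} → IsFlat M F → Nonempty F → ∣ to (A.qSet F) ∣ ≡ coneSize m ∣ F ∣
  ∣to-q∣ {F} F-flat F≢∅ = trans (size _ (A.q-cf F-flat F≢∅)) (A.∣q∣ F)

  -- The preimage of q(E') lies below the greatest cyclic flat q(E); `to` carries this inclusion
  -- back. The two elements make both ground sets nonempty, as cones require.
  q⊤⊆to-q⊤ : Fin n → Fin n' → B.qSet ⊤ ⊆ to (A.qSet ⊤)
  q⊤⊆to-q⊤ d e {x} x∈ = to-mono (from-cf _ q⊤-cf) (A.q-cf (⊤-flat M) (d , ∈⊤)) (A.⊆q⊤ (from-cf _ q⊤-cf))
    (subst (x ∈_) (sym (to-from _ q⊤-cf)) x∈)
    where
    q⊤-cf : IsCyclicFlat QN (B.qSet ⊤)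
    q⊤-cf = B.q-cf (⊤-flat N) (e , ∈⊤)

  to-q⊤ : Fin n → to (A.qSet ⊤) ≡ B.qSet ⊤
  to-q⊤ d with B.classify (to-cf _ (A.q-cf (⊤-flat M) (d , ∈⊤)))
  ... | inj₂ (G , _ , (e , _) , to≡q) =
    ⊆-antisym (subst (_⊆ B.qSet ⊤) (sym to≡q) (B.q-mono ⊆⊤)) (q⊤⊆to-q⊤ d e)
  -- E' is not yet known to be nonempty: an element of Z would show it, and an empty Z is too small
  -- to be the image of a cone.
  ... | inj₁ (Z , _ , to≡emb) with nonempty? Z
  ...   | yes (e , _) = ⊥-elim (B.q⊈emb {⊤} {Z} λ {x} x∈ → subst (x ∈_) to≡emb (q⊤⊆to-q⊤ d e x∈))
  ...   | no Z≡∅ = contradiction coneSize≡0 λ ()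
    where
    coneSize≡0 : coneSize m ∣ ⊤ {n} ∣ ≡ 0
    coneSize≡0 = begin
      coneSize m ∣ ⊤ {n} ∣ ≡⟨ ∣to-q∣ (⊤-flat M) (d , ∈⊤) ⟨
      ∣ to (A.qSet ⊤) ∣    ≡⟨ cong ∣_∣ to≡emb ⟩
      ∣ B.embE Z ∣         ≡⟨ B.∣emb∣ Z ⟩
      ∣ Z ∣                ≡⟨ cong ∣_∣ (Empty-unique Z≡∅) ⟩
      ∣ ⊥ {n'} ∣           ≡⟨ ∣⊥∣≡0 n' ⟩
      0                    ∎
      where open ≡-Reasoning

  n≡n' : Fin n → n ≡ n'
  n≡n' d = coneSize-injective m (begin
    coneSize m n         ≡⟨ cong (coneSize m) (∣⊤∣≡n n) ⟨
    coneSize m ∣ ⊤ {n} ∣ ≡⟨ ∣to-q∣ (⊤-flat M) (d , ∈⊤) ⟨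
    ∣ to (A.qSet ⊤) ∣    ≡⟨ cong ∣_∣ (to-q⊤ d) ⟩
    ∣ B.qSet ⊤ ∣         ≡⟨ B.∣q∣ ⊤ ⟩
    coneSize m ∣ ⊤ {n'} ∣ ≡⟨ cong (coneSize m) (∣⊤∣≡n n') ⟩
    coneSize m n'        ∎)
    where open ≡-Reasoning

  r⊤≡r⊤ : Fin n → r M ⊤ ≡ r N ⊤
  r⊤≡r⊤ d = suc-injective (begin
    suc (r M ⊤)          ≡⟨ r-to-q (⊤-flat M) (d , ∈⊤) ⟨
    r QN (to (A.qSet ⊤)) ≡⟨ cong (r QN) (to-q⊤ d) ⟩
    r QN (B.qSet ⊤)      ≡⟨ B.rankQ ⊤ (⊤-flat N) (subst Fin (n≡n' d) d , ∈⊤) ⟩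
    suc (r N ⊤)          ∎)
    where open ≡-Reasoning

  ToCone ToBase : Subset n → Set
  ToCone F = Σ (Subset n') λ G → IsFlat N G × Nonempty G × to (A.qSet F) ≡ B.qSet G
  ToBase F = to (A.qSet F) ≡ B.embE ⊤

  -- If q(F) were sent to a cyclic flat Z ≠ E(N) of N, the covers of F would be sent to q(Z) or E(N),
  -- the only images available at rank r(Z) + 1.  So F would have just two covers, of sizes |Z| and
  -- (|E| - 1)/(m + 1), and these are too small to cover E.
  module ToSmallBase {F : Subset n} (F-flat : IsFlat M F) (F≢∅ : Nonempty F)
    (ih : ∀ {G} → F ⊂ G → IsFlat M G → Nonempty G → ToCone G ⊎ ToBase G)
    {Z : Subset n'} (Z-cf : IsCyclicFlat N Z) (to≡emb : to (A.qSet F) ≡ B.embE Z) (Z≢⊤ : Z ≢ ⊤) where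

    d : Fin n
    d = proj₁ F≢∅

    rZ : r N Z ≡ suc (r M F)
    rZ = begin
      r N Z                ≡⟨ B.rankZ Z Z-cf ⟨
      r QN (B.embE Z)      ≡⟨ cong (r QN) to≡emb ⟨
      r QN (to (A.qSet F)) ≡⟨ r-to-q F-flat F≢∅ ⟩
      suc (r M F)          ∎
      where open ≡-Reasoning

    ∣Z∣ : ∣ Z ∣ ≡ coneSize m ∣ F ∣
    ∣Z∣ = begin
      ∣ Z ∣               ≡⟨ B.∣emb∣ Z ⟨
      ∣ B.embE Z ∣        ≡⟨ cong ∣_∣ to≡emb ⟨
      ∣ to (A.qSet F) ∣   ≡⟨ ∣to-q∣ F-flat F≢∅ ⟩
      coneSize m ∣ F ∣    ∎
      where open ≡-Reasoning

    record CoverOf (G : Subset n) : Set where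
      field
        F⊂G    : F ⊂ G
        G-flat : IsFlat M G
        rG     : r M G ≡ suc (r M F)

      G≢∅ : Nonempty G
      G≢∅ = d , proj₁ F⊂G (proj₂ F≢∅)

      qG-cf : IsCyclicFlat QM (A.qSet G)
      qG-cf = A.q-cf G-flat G≢∅

      -- If the image is a cone q(G'), then Z lies in G' because q(F) lies in q(G). The ranks of Z
      -- and G' agree, so the flat Z is all of G'.
      cover-image : to (A.qSet G) ≡ B.qSet Z ⊎ ToBase G
      cover-image with ih F⊂G G-flat G≢∅
      ... | inj₂ to-base = inj₂ to-base
      ... | inj₁ (G' , G'-flat , G'≢∅ , to≡q) =
        inj₁ (trans to≡q (cong B.qSet (flat-⊆-rank N (proj₂ Z-cf) Z⊆G' (≤-reflexive rG'))))
        where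
        Z⊆G' : Z ⊆ G'
        Z⊆G' = B.emb-q-cancel λ {x} x∈ → subst (x ∈_) to≡q
          (to-mono (A.q-cf F-flat F≢∅) qG-cf (A.q-mono (proj₁ F⊂G)) (subst (x ∈_) (sym to≡emb) x∈))

        rG' : r N G' ≡ r N Z
        rG' = suc-injective (begin
          suc (r N G')         ≡⟨ B.rankQ G' G'-flat G'≢∅ ⟨
          r QN (B.qSet G')     ≡⟨ cong (r QN) to≡q ⟨
          r QN (to (A.qSet G)) ≡⟨ r-to-q G-flat G≢∅ ⟩
          suc (r M G)          ≡⟨ cong suc rG ⟩
          suc (suc (r M F))    ≡⟨ cong suc rZ ⟨
          suc (r N Z)          ∎)
          where open ≡-Reasoning

    open CoverOf

    cover-through : ∀ {e} → e ∉ F → Σ (Subset n) λ G → CoverOf G × e ∈ G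
    cover-through {e} e∉F = cover , record
      { F⊂G    = ⊆-cover , e , ∈-cover , e∉F
      ; G-flat = cl-flat M _
      ; rG     = r-cover
      } , ∈-cover
      where open Cover M F-flat e∉F

    same-image : ∀ {G H} → CoverOf G → CoverOf H → to (A.qSet G) ≡ to (A.qSet H) → G ≡ H
    same-image G-cover H-cover eq = A.q-injective (to-injective (qG-cf G-cover) (qG-cf H-cover) eq)

    -- Here t = |F|, u = |H| and s = |G ∩ H| for two covers with union E; the equation is |E| + |G ∩
    -- H| = |G| + |H|. Cancelling 1 + u leaves um + s = tm + t, which m ≥ 1 forbids.
    sizes-clash : ∀ {s t u} → t < u → t ≤ s → coneSize m u + s ≢ coneSize m t + u
    sizes-clash {s} {t} {u} t<u t≤s eq = <-irrefl (sym balance) (+-mono-<-≤ (*-monoˡ-< m {{>-nonZero m≥1}} t<u) t≤s)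
      where
      regroup : ∀ a b c → a + b + c ≡ (b + c) + a
      regroup = solve-∀

      swap : ∀ a b c → a + b + c ≡ (b + a) + c
      swap = solve-∀

      balance : u * m + s ≡ t * m + t
      balance = +-cancelʳ-≡ u (u * m + s) (t * m + t)
        (trans (sym (regroup u (u * m) s)) (trans (suc-injective eq) (swap t (t * m) u)))

    two-covers : ∀ {G H} → CoverOf G → CoverOf H → to (A.qSet G) ≡ B.qSet Z → ¬ ToBase H
    two-covers {G} {H} G-cover H-cover G↦qZ H↦⊤ with full-or-missing (G ∪ H)
    ... | inj₁ G∪H≡⊤ = sizes-clash
        (p⊂q⇒∣p∣<∣q∣ (F⊂G H-cover))
        (p⊆q⇒∣p∣≤∣q∣ {p = F} {q = G ∩ H} (λ x∈F → x∈p∩q⁺ (proj₁ (F⊂G G-cover) x∈F , proj₁ (F⊂G H-cover) x∈F)))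
        (begin
          coneSize m ∣ H ∣ + ∣ G ∩ H ∣  ≡⟨ cong (_+ ∣ G ∩ H ∣) ∣H∣ ⟩
          n + ∣ G ∩ H ∣                 ≡⟨ cong (_+ ∣ G ∩ H ∣) (∣⊤∣≡n n) ⟨
          ∣ ⊤ {n} ∣ + ∣ G ∩ H ∣         ≡⟨ cong (λ U → ∣ U ∣ + ∣ G ∩ H ∣) G∪H≡⊤ ⟨
          ∣ G ∪ H ∣ + ∣ G ∩ H ∣         ≡⟨ ∣S∪T∣+∣S∩T∣≡∣S∣+∣T∣ G H ⟩
          ∣ G ∣ + ∣ H ∣                 ≡⟨ cong (_+ ∣ H ∣) (trans ∣G∣ ∣Z∣) ⟩
          coneSize m ∣ F ∣ + ∣ H ∣      ∎)
      where
      open ≡-Reasoning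

      ∣H∣ : coneSize m ∣ H ∣ ≡ n
      ∣H∣ = begin
        coneSize m ∣ H ∣    ≡⟨ ∣to-q∣ (G-flat H-cover) (G≢∅ H-cover) ⟨
        ∣ to (A.qSet H) ∣   ≡⟨ cong ∣_∣ H↦⊤ ⟩
        ∣ B.embE ⊤ ∣        ≡⟨ B.∣emb∣ ⊤ ⟩
        ∣ ⊤ {n'} ∣          ≡⟨ ∣⊤∣≡n n' ⟩
        n'                  ≡⟨ n≡n' d ⟨
        n                   ∎

      ∣G∣ : ∣ G ∣ ≡ ∣ Z ∣
      ∣G∣ = coneSize-injective m (begin
        coneSize m ∣ G ∣    ≡⟨ ∣to-q∣ (G-flat G-cover) (G≢∅ G-cover) ⟨
        ∣ to (A.qSet G) ∣   ≡⟨ cong ∣_∣ G↦qZ ⟩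
        ∣ B.qSet Z ∣        ≡⟨ B.∣q∣ Z ⟩
        coneSize m ∣ Z ∣    ∎)
    -- An element outside both covers lies in a third, whose cone would share its image with that of
    -- G or H.
    ... | inj₂ (e , e∉G∪H) with cover-through (e∉G∪H ∘ p⊆p∪q H ∘ proj₁ (F⊂G G-cover))
    ...   | K , K-cover , e∈K with cover-image K-cover
    ...     | inj₁ K↦qZ = e∉G∪H (p⊆p∪q H (subst (e ∈_) (same-image K-cover G-cover (trans K↦qZ (sym G↦qZ))) e∈K))
    ...     | inj₂ K↦⊤  = e∉G∪H (q⊆p∪q G H (subst (e ∈_) (same-image K-cover H-cover (trans K↦⊤ (sym H↦⊤))) e∈K))

    -- The image of q(E) is q(E'), which is neither q(Z), as Z is not E', nor E'.
    ⊤-not-cover : ¬ CoverOf ⊤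
    ⊤-not-cover ⊤-cover with cover-image ⊤-cover
    ... | inj₁ ⊤↦qZ = Z≢⊤ (B.q-injective (trans (sym ⊤↦qZ) (to-q⊤ d)))
    ... | inj₂ ⊤↦⊤  = B.q≢emb (trans (sym (to-q⊤ d)) ⊤↦⊤)

    -- F is proper, and a cover of F is proper too, so an element outside it gives a second cover.
    -- Distinct covers have distinct images, which leaves exactly the situation of `two-covers`.
    absurd : Absurd
    absurd with full-or-missing F
    ... | inj₁ refl = B.q≢emb (trans (sym (to-q⊤ d)) to≡emb)
    ... | inj₂ (e , e∉F) with cover-through e∉F
    ...   | G , G-cover , _ with full-or-missing G
    ...     | inj₁ refl = ⊤-not-cover G-cover
    ...     | inj₂ (h , h∉G) with cover-through (h∉G ∘ proj₁ (F⊂G G-cover))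
    ...       | H , H-cover , h∈H with cover-image G-cover | cover-image H-cover
    ...         | inj₁ G↦qZ | inj₁ H↦qZ = h∉G (subst (h ∈_) (same-image H-cover G-cover (trans H↦qZ (sym G↦qZ))) h∈H)
    ...         | inj₁ G↦qZ | inj₂ H↦⊤  = two-covers G-cover H-cover G↦qZ H↦⊤
    ...         | inj₂ G↦⊤  | inj₁ H↦qZ = two-covers H-cover G-cover H↦qZ G↦⊤
    ...         | inj₂ G↦⊤  | inj₂ H↦⊤  = h∉G (subst (h ∈_) (same-image H-cover G-cover (trans H↦⊤ (sym G↦⊤))) h∈H)

  abstract
    q-image-acc : ∀ {F} → Acc (λ S T → T ⊂ S) F → IsFlat M F → Nonempty F → ToCone F ⊎ ToBase F
    q-image-acc {F} (acc rec) F-flat F≢∅ with B.classify (to-cf _ (A.q-cf F-flat F≢∅))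
    ... | inj₂ to-cone = inj₁ to-cone
    ... | inj₁ (Z , Z-cf , to≡emb) with Z ≟ₛ ⊤
    ...   | yes refl = inj₂ to≡emb
    ...   | no Z≢⊤ = ⊥-elim (ToSmallBase.absurd F-flat F≢∅ (λ F⊂G → q-image-acc (rec F⊂G)) Z-cf to≡emb Z≢⊤)

    q-image : ∀ {F} → IsFlat M F → Nonempty F → ToCone F ⊎ ToBase F
    q-image {F} = q-image-acc (⊃-wellFounded F)

-- Matching the nonempty flats of M and N

module Correspondence (m≥1 : m ≥ 1) {M : Matroid n} {N : Matroid n'}
  (looplessM : Loopless M) (looplessN : Loopless N)
  {QM : Matroid k} {labM : Fin k ↔ ConeElt n m} (C : IsFreeCone m M QM labM)
  {QN : Matroid k'} {labN : Fin k' ↔ ConeElt n' m} (C' : IsFreeCone m N QN labN)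
  (conf : SameConfiguration QM QN) where

  open SameConfiguration conf
  open ConeConfiguration m≥1 C C' conf
  private
    module A = FreeCone C
    module B = FreeCone C'
    module Back = ConeConfiguration m≥1 C' C (SameConfiguration-sym conf)

  -- A configuration isomorphism may interchange E with a single cone q(F)
  -- (for instance when M is U_{2,m+2}); `swapped` undoes this.
  data _~_ (F : Subset n) (G : Subset n') : Set where
    direct  : to (A.qSet F) ≡ B.qSet G → F ~ G
    swapped : IsCyclicFlat QM (A.embE ⊤) → to (A.qSet F) ≡ B.embE ⊤ → to (A.embE ⊤) ≡ B.qSet G → F ~ G

  -- In the mixed cases, no cone fits inside E', and E' inside q(G₂) forces G₂ = E'.
  ~-mono : ∀ {F₁ F₂ G₁ G₂} → IsFlat M F₁ → Nonempty F₁ → IsFlat M F₂ → Nonempty F₂ →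
    F₁ ~ G₁ → F₂ ~ G₂ → F₁ ⊆ F₂ → G₁ ⊆ G₂
  ~-mono {F₁} {F₂} {G₁} {G₂} F₁-flat F₁≢∅ F₂-flat F₂≢∅ F₁~G₁ F₂~G₂ F₁⊆F₂ = compare F₁~G₁ F₂~G₂
    where
    images : to (A.qSet F₁) ⊆ to (A.qSet F₂)
    images = to-mono (A.q-cf F₁-flat F₁≢∅) (A.q-cf F₂-flat F₂≢∅) (A.q-mono F₁⊆F₂)

    images≡ : ∀ {X Y} → to (A.qSet F₁) ≡ X → to (A.qSet F₂) ≡ Y → X ⊆ Y
    images≡ refl refl = images

    compare : F₁ ~ G₁ → F₂ ~ G₂ → G₁ ⊆ G₂
    compare (direct F₁↦G₁)      (direct F₂↦G₂)      = B.q-cancel (images≡ F₁↦G₁ F₂↦G₂)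
    compare (direct F₁↦G₁)      (swapped _ F₂↦⊤ _)  = ⊥-elim (B.q⊈emb (images≡ F₁↦G₁ F₂↦⊤))
    compare (swapped _ F₁↦⊤ _)  (direct F₂↦G₂)      = λ _ → B.emb-q-cancel (images≡ F₁↦⊤ F₂↦G₂) ∈⊤
    compare (swapped _ _ ⊤↦G₁)  (swapped _ _ ⊤↦G₂)  = B.q-cancel (⊆-reflexive (trans (sym ⊤↦G₁) ⊤↦G₂))

  -- The same comparison on the side of M: in a swapped pair the preimage of q(G) is E, which
  -- contains no cone and lies only in q(E).
  ~-cancel : ∀ {F₁ F₂ G₁ G₂} → IsFlat M F₁ → Nonempty F₁ → IsFlat M F₂ → Nonempty F₂ →
    F₁ ~ G₁ → F₂ ~ G₂ → G₁ ⊆ G₂ → F₁ ⊆ F₂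
  ~-cancel {F₁} {F₂} {G₁} {G₂} F₁-flat F₁≢∅ F₂-flat F₂≢∅ F₁~G₁ F₂~G₂ G₁⊆G₂ = compare F₁~G₁ F₂~G₂
    where
    F₁-cf : IsCyclicFlat QM (A.qSet F₁)
    F₁-cf = A.q-cf F₁-flat F₁≢∅

    F₂-cf : IsCyclicFlat QM (A.qSet F₂)
    F₂-cf = A.q-cf F₂-flat F₂≢∅

    images≡ : ∀ {X Y} → X ≡ B.qSet G₁ → Y ≡ B.qSet G₂ → X ⊆ Y
    images≡ refl refl = B.q-mono G₁⊆G₂

    compare : F₁ ~ G₁ → F₂ ~ G₂ → F₁ ⊆ F₂
    compare (direct F₁↦G₁)         (direct F₂↦G₂)         =
      A.q-cancel (to-cancel F₁-cf F₂-cf (images≡ F₁↦G₁ F₂↦G₂))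
    compare (direct F₁↦G₁)         (swapped ⊤-cf _ ⊤↦G₂)  =
      ⊥-elim (A.q⊈emb (to-cancel F₁-cf ⊤-cf (images≡ F₁↦G₁ ⊤↦G₂)))
    compare (swapped ⊤-cf _ ⊤↦G₁)  (direct F₂↦G₂)         =
      λ _ → A.emb-q-cancel (to-cancel ⊤-cf F₂-cf (images≡ ⊤↦G₁ F₂↦G₂)) ∈⊤
    compare (swapped _ F₁↦⊤ _)     (swapped _ F₂↦⊤ _)     =
      A.q-cancel (⊆-reflexive (to-injective F₁-cf F₂-cf (trans F₁↦⊤ (sym F₂↦⊤))))

  -- For a swapped pair the two cones have sizes |E'| and |E|, which are equal.
  ~-size : ∀ {F G} → IsFlat M F → Nonempty F → F ~ G → ∣ F ∣ ≡ ∣ G ∣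
  ~-size {F} {G} F-flat F≢∅ (direct F↦G) = coneSize-injective m (begin
    coneSize m ∣ F ∣   ≡⟨ ∣to-q∣ F-flat F≢∅ ⟨
    ∣ to (A.qSet F) ∣  ≡⟨ cong ∣_∣ F↦G ⟩
    ∣ B.qSet G ∣       ≡⟨ B.∣q∣ G ⟩
    coneSize m ∣ G ∣   ∎)
    where open ≡-Reasoning
  ~-size {F} {G} F-flat F≢∅ (swapped ⊤-cf F↦⊤ ⊤↦G) = coneSize-injective m (begin
    coneSize m ∣ F ∣   ≡⟨ ∣to-q∣ F-flat F≢∅ ⟨
    ∣ to (A.qSet F) ∣  ≡⟨ cong ∣_∣ F↦⊤ ⟩
    ∣ B.embE ⊤ ∣       ≡⟨ B.∣emb∣ ⊤ ⟩
    ∣ ⊤ {n'} ∣         ≡⟨ cong (λ i → ∣ ⊤ {i} ∣) (n≡n' (proj₁ F≢∅)) ⟨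
    ∣ ⊤ {n} ∣          ≡⟨ A.∣emb∣ ⊤ ⟨
    ∣ A.embE ⊤ ∣       ≡⟨ size _ ⊤-cf ⟨
    ∣ to (A.embE ⊤) ∣  ≡⟨ cong ∣_∣ ⊤↦G ⟩
    ∣ B.qSet G ∣       ≡⟨ B.∣q∣ G ⟩
    coneSize m ∣ G ∣   ∎)
    where open ≡-Reasoning

  ~-rank : ∀ {F G} → IsFlat M F → Nonempty F → IsFlat N G → Nonempty G → F ~ G → r M F ≡ r N G
  ~-rank {F} {G} F-flat F≢∅ G-flat G≢∅ (direct F↦G) = suc-injective (begin
    suc (r M F)          ≡⟨ r-to-q F-flat F≢∅ ⟨
    r QN (to (A.qSet F)) ≡⟨ cong (r QN) F↦G ⟩
    r QN (B.qSet G)      ≡⟨ B.rankQ G G-flat G≢∅ ⟩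
    suc (r N G)          ∎)
    where open ≡-Reasoning
  ~-rank {F} {G} F-flat F≢∅ G-flat G≢∅ (swapped ⊤-cf F↦⊤ ⊤↦G) = suc-injective (begin
    suc (r M F)          ≡⟨ r-to-q F-flat F≢∅ ⟨
    r QN (to (A.qSet F)) ≡⟨ cong (r QN) F↦⊤ ⟩
    r QN (B.embE ⊤)      ≡⟨ B.r-emb⊤ (subst (IsCyclicFlat QN) F↦⊤ (to-cf _ (A.q-cf F-flat F≢∅))) ⟩
    r N ⊤                ≡⟨ r⊤≡r⊤ (proj₁ F≢∅) ⟨
    r M ⊤                ≡⟨ A.r-emb⊤ ⊤-cf ⟨
    r QM (A.embE ⊤)      ≡⟨ rank _ ⊤-cf ⟨
    r QN (to (A.embE ⊤)) ≡⟨ cong (r QN) ⊤↦G ⟩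
    r QN (B.qSet G)      ≡⟨ B.rankQ G G-flat G≢∅ ⟩
    suc (r N G)          ∎)
    where open ≡-Reasoning

  -- If no cone over a flat of N came back to E(M), then q⁻¹ ∘ from ∘ q would embed the points of N,
  -- hence its elements, into M, missing the elements of F.
  module NoFromBase
    (none : ¬ ∃ λ G → IsFlat N G × Nonempty G × from (B.qSet G) ≡ A.embE ⊤)
    {F : Subset n} (F-flat : IsFlat M F) (F≢∅ : Nonempty F) (F↦⊤ : ToBase F) where

    point≢∅ : ∀ e → Nonempty (point N e)
    point≢∅ e = e , e∈point N e

    abstract
      from-q : ∀ e → Back.ToCone (point N e)
      from-q e with Back.q-image (point-flat N e) (point≢∅ e)
      ... | inj₁ to-cone = to-cone
      ... | inj₂ to-base = ⊥-elim (none (point N e , point-flat N e , point≢∅ e , to-base))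

    φ : Fin n' → Subset n
    φ e = proj₁ (from-q e)

    φ-flat : ∀ e → IsFlat M (φ e)
    φ-flat e = proj₁ (proj₂ (from-q e))

    φ≢∅ : ∀ e → Nonempty (φ e)
    φ≢∅ e = proj₁ (proj₂ (proj₂ (from-q e)))

    φ↦point : ∀ e → to (A.qSet (φ e)) ≡ B.qSet (point N e)
    φ↦point e = trans (cong to (sym (proj₂ (proj₂ (proj₂ (from-q e)))))) (to-from _ (B.q-cf (point-flat N e) (point≢∅ e)))

    abstract
      elementMap : PointMap M φ
      elementMap = pointMap N M looplessM φ φ-flat
        (λ e → trans (~-rank (φ-flat e) (φ≢∅ e) (point-flat N e) (point≢∅ e) (direct (φ↦point e)))
                     (r-point N looplessN e))
        (λ e → sym (~-size (φ-flat e) (φ≢∅ e) (direct (φ↦point e))))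
        (λ {d} {e} φd≡φe → B.q-injective
          (trans (sym (φ↦point d)) (trans (cong (to ∘ A.qSet) φd≡φe) (φ↦point e))))

    open PointMap elementMap

    -- Otherwise φ e, being the point of f e, lies in F, and applying `to` puts the cone over the
    -- point of e inside E', which lacks the tip.
    f∉F : ∀ e → f e ∉ F
    f∉F e fe∈F = B.q⊈emb {S = point N e} {T = ⊤} λ {z} z∈ → subst (z ∈_) F↦⊤
      (to-mono (A.q-cf (φ-flat e) (φ≢∅ e)) (A.q-cf F-flat F≢∅) (A.q-mono φ⊆F)
        (subst (z ∈_) (sym (φ↦point e)) z∈))
      where
      φ⊆F : φ e ⊆ F
      φ⊆F = subst (_⊆ F) (sym (φ≡point e)) (point⊆ M F-flat fe∈F)

    absurd : Absurd
    absurd =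
      -- Since |E| = |E'|, the injection f also hits the elements of F.
      let x , x∈F  = F≢∅
          e , fe≡x = injective⇒surjective (sym (n≡n' x)) f-injective x
      in f∉F e (subst (_∈ F) (sym fe≡x) x∈F)

  abstract
    -- The absence of G is refuted rather than G constructed, so G is obtained by a decidable search
    -- through all subsets.
    ToBase⇒FromBase : ∀ {F} → IsFlat M F → Nonempty F → ToBase F →
      ∃ λ G → IsFlat N G × Nonempty G × from (B.qSet G) ≡ A.embE ⊤
    ToBase⇒FromBase F-flat F≢∅ F↦⊤
      with anySubset? (λ G → isFlat? N G ×-dec (nonempty? G ×-dec (from (B.qSet G) ≟ₛ A.embE ⊤)))
    ... | yes found = found
    ... | no none   = ⊥-elim (NoFromBase.absurd none F-flat F≢∅ F↦⊤)

  abstract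
    ~-total : ∀ {F} → IsFlat M F → Nonempty F → ∃ λ G → IsFlat N G × Nonempty G × F ~ G
    ~-total F-flat F≢∅ with q-image F-flat F≢∅
    ... | inj₁ (G , G-flat , G≢∅ , F↦G) = G , G-flat , G≢∅ , direct F↦G
    ... | inj₂ F↦⊤ with ToBase⇒FromBase F-flat F≢∅ F↦⊤
    ...   | G , G-flat , G≢∅ , G↦⊤ = G , G-flat , G≢∅ , swapped
        (subst (IsCyclicFlat QM) G↦⊤ (from-cf _ (B.q-cf G-flat G≢∅)))
        F↦⊤
        (trans (cong to (sym G↦⊤)) (to-from _ (B.q-cf G-flat G≢∅)))

-- Both directions of the matching combined

module Reconstruction (m≥1 : m ≥ 1) {M : Matroid n} {N : Matroid n'}
  (looplessM : Loopless M) (looplessN : Loopless N)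
  {QM : Matroid k} {labM : Fin k ↔ ConeElt n m} (C : IsFreeCone m M QM labM)
  {QN : Matroid k'} {labN : Fin k' ↔ ConeElt n' m} (C' : IsFreeCone m N QN labN)
  (conf : SameConfiguration QM QN) where

  open SameConfiguration conf
  open Correspondence m≥1 looplessM looplessN C C' conf
  private
    module B = FreeCone C'
    module Forth = ConeConfiguration m≥1 C C' conf
    module Back  = ConeConfiguration m≥1 C' C (SameConfiguration-sym conf)
    module Rev   = Correspondence m≥1 looplessN looplessM C' C (SameConfiguration-sym conf)

  -- Each direction needs an element of its own ground set, since a cone needs a nonempty flat; if
  -- both sets are empty there is nothing to compare.
  equicardinal : n ≡ n'
  equicardinal = compare Forth.n≡n' Back.n≡n'
    where
    compare : ∀ {i j} → (Fin i → i ≡ j) → (Fin j → j ≡ i) → i ≡ j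
    compare {zero}  {zero}  _     _    = refl
    compare {suc _} {_}     forth _    = forth zero
    compare {zero}  {suc _} _     back = sym (back zero)

  -- Inverting the isomorphism turns a swap into a swap with its two equations exchanged. Hence
  -- totality for the inverse gives `~-onto`.
  Rev-~⇒~ : ∀ {F G} → IsFlat N G → Nonempty G → G Rev.~ F → F ~ G
  Rev-~⇒~ G-flat G≢∅ (Rev.direct G↦F) = direct (trans (cong to (sym G↦F)) (to-from _ (B.q-cf G-flat G≢∅)))
  Rev-~⇒~ G-flat G≢∅ (Rev.swapped ⊤-cf G↦⊤ ⊤↦F) = swapped
    (subst (IsCyclicFlat QM) G↦⊤ (from-cf _ (B.q-cf G-flat G≢∅)))
    (trans (cong to (sym ⊤↦F)) (to-from _ ⊤-cf))
    (trans (cong to (sym G↦⊤)) (to-from _ (B.q-cf G-flat G≢∅)))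

  ~-onto : ∀ {G} → IsFlat N G → Nonempty G → ∃ λ F → IsFlat M F × Nonempty F × F ~ G
  ~-onto G-flat G≢∅ = let F , F-flat , F≢∅ , G~F = Rev.~-total G-flat G≢∅ in F , F-flat , F≢∅ , Rev-~⇒~ G-flat G≢∅ G~F

  isomorphic : Isomorphic M N
  isomorphic = FlatCorrespondence.isomorphic M N looplessM looplessN equicardinal
    _~_ ~-mono ~-cancel ~-size ~-rank ~-total ~-onto

theorem3p8 : (m : ℕ) → m ≥ 1 →
    {n n' k k' : ℕ} (M : Matroid n) (N : Matroid n') →
    Loopless M → Loopless N →
    (QM : Matroid k) (labM : Fin k ↔ ConeElt n m) → IsFreeCone m M QM labM →
    (QN : Matroid k') (labN : Fin k' ↔ ConeElt n' m) → IsFreeCone m N QN labN →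
    SameConfiguration QM QN →
    Isomorphic M N
theorem3p8 m m≥1 M N looplessM looplessN QM labM C QN labN C' conf =
  Reconstruction.isomorphic m≥1 looplessM looplessN C C' conf
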